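{- If $T$ is an (undirected) forest and $\overset{\leftrightarrow}{T}$ denotes its biorientation, then $\text{mader}_{\vec{\chi}}(\overset{\leftrightarrow}{T})=v(\overset{\leftrightarrow}{T})$.
   Context: Graphs and digraphs are finite with a nonempty vertex set. Digraphs are loopless and have no parallel arcs, but may contain anti-parallel pairs of arcs $(x,y),(y,x)$ (digons). $v(D)$ denotes the number of vertices of a digraph $D$. The biorientation $\overset{\leftrightarrow}{G}$ of an undirected graph $G$ is the digraph on $V(G)$ obtained by replacing each edge $\{x,y\}$ of $G$ with both arcs $(x,y),(y,x)$. An acyclic $k$-coloring of $D$ is a map $c:V(D)\to\{1,\dots,k\}$ such that each color class $c^{ -1}(i)$ induces an acyclic subdigraph (one with no directed cycle; a digon is a directed cycle of length 2). The dichromatic number $\vec{\chi}(D)$ is the smallest $k\in\mathbb{N}$ for which $D$ has an acyclic $k$-coloring. A subdivision of a digraph $F$ is any digraph obtained by replacing every arc $(x,y)$ of $F$ by a directed path from $x$ to $y$ (of length at least 1), where the subdivision paths of different arcs are internally vertex-disjoint (and their internal vertices are new vertices). A digraph $D$ contains a subdivision of $F$ if some subdigraph of $D$ is isomorphic to a subdivision of $F$. $\text{mader}_{\vec{\chi}}(F)$ denotes the smallest integer $k\ge 1$ such that every digraph $D$ with $\vec{\chi}(D)\ge k$ contains a subdivision of $F$ (it is known that such a $k$ exists for every digraph $F$). -}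

module Defs where

open import Data.Bool.Base using (Bool; T)
open import Data.Fin.Base using (Fin)
open import Data.List.Base using (List; []; _∷_; [_]; _++_; length)
open import Data.List.Membership.Propositional using (_∈_; _∉_)
open import Data.List.Relation.Binary.Disjoint.Propositional using (Disjoint)
open import Data.List.Relation.Binary.Infix.Heterogeneous using (Infix)
open import Data.List.Relation.Unary.All using (All)
open import Data.List.Relation.Unary.Linked using (Linked)
open import Data.List.Relation.Unary.Unique.Propositional using (Unique)
open import Data.Nat.Base using (ℕ; NonZero; _≤_; _≥_)
open import Data.Product.Base using (Σ; ∃; ∃-syntax; _×_; _,_)
open import Data.Sum.Base using (_⊎_)
open import Function.Definitions using (Injective)
open import Relation.Binary.PropositionalEquality.Core using (_≡_; _≢_)
open import Relation.Nullary.Negation.Core using (¬_)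

record Graph : Set where
  field
    order    : ℕ
    nonempty : NonZero order
    edge     : Fin order → Fin order → Bool

  V : Set
  V = Fin order

  _∼_ : V → V → Set
  x ∼ y = T (edge x y)

  field
    symmetric : ∀ x y → x ∼ y → y ∼ x
    loopless  : ∀ x → ¬ (x ∼ x)

-- A Boolean arc function rules out parallel arcs but allows digons.
record Digraph : Set where
  field
    order    : ℕ
    nonempty : NonZero order
    arc      : Fin order → Fin order → Bool

  V : Set
  V = Fin order

  _⟶_ : V → V → Set
  x ⟶ y = T (arc x y)

  field
    loopless : ∀ x → ¬ (x ⟶ x)

v : Digraph → ℕ
v = Digraph.order

biorientation : Graph → Digraph
biorientation G = record
  { order    = Graph.order G
  ; nonempty = Graph.nonempty G
  ; arc      = Graph.edge G
  ; loopless = Graph.loopless G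
  }

-- The cycle x₀ x₁ … xₗ x₀ is given by x₀ and the list x₁ … xₗ; l ≥ 2 excludes
-- walking back and forth along one edge.
IsCycle : (G : Graph) → Graph.V G → List (Graph.V G) → Set
IsCycle G x xs =
  Linked (Graph._∼_ G) (x ∷ xs ++ [ x ]) × Unique (x ∷ xs) × length xs ≥ 2

IsForest : Graph → Set
IsForest G = ∀ x xs → ¬ IsCycle G x xs

-- Here l ≥ 1 is automatic by looplessness, and l = 1 is a digon.
IsDicycle : (D : Digraph) → Digraph.V D → List (Digraph.V D) → Set
IsDicycle D x xs =
  Linked (Digraph._⟶_ D) (x ∷ xs ++ [ x ]) × Unique (x ∷ xs)

-- The directed cycles of the subdigraph induced by P are the directed cycles
-- of D all of whose vertices satisfy P.
InducesAcyclic : (D : Digraph) → (Digraph.V D → Set) → Set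
InducesAcyclic D P = ∀ x xs → All P (x ∷ xs) → ¬ IsDicycle D x xs

AcyclicColorable : Digraph → ℕ → Set
AcyclicColorable D k =
  Σ (Digraph.V D → Fin k) λ c → ∀ i → InducesAcyclic D (λ x → c x ≡ i)

IsLeast : (ℕ → Set) → ℕ → Set
IsLeast P k = P k × (∀ j → P j → k ≤ j)

IsDichromaticNumber : Digraph → ℕ → Set
IsDichromaticNumber D = IsLeast (AcyclicColorable D)

record DiPath (D : Digraph) (x y : Digraph.V D) : Set where
  field
    inner : List (Digraph.V D)

  vertices : List (Digraph.V D)
  vertices = x ∷ inner ++ [ y ]

  field
    linked : Linked (Digraph._⟶_ D) vertices
    unique : Unique vertices

record IsSubdivision (S F : Digraph) : Set where
  private
    module S = Digraph S
    module F = Digraph F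

  field
    branch           : F.V → S.V
    branch-injective : Injective _≡_ _≡_ branch
    path             : ∀ x y → x F.⟶ y → DiPath S (branch x) (branch y)

  inner : ∀ x y → x F.⟶ y → List S.V
  inner x y e = DiPath.inner (path x y e)

  field
    inner-new : ∀ x y e z → branch z ∉ inner x y e

    inner-disjoint : ∀ x y e x′ y′ e′ → (x , y) ≢ (x′ , y′) →
                     Disjoint (inner x y e) (inner x′ y′ e′)

    -- S has no vertices and no arcs besides those of the subdivision paths
    -- and the branch vertices.
    vertex-covered : ∀ u → (∃[ x ] u ≡ branch x) ⊎
                           (∃[ x ] ∃[ y ] ∃[ e ] u ∈ inner x y e)

    arc-covered : ∀ u w → u S.⟶ w → ∃[ x ] ∃[ y ] Σ (x F.⟶ y) λ e →
                  Infix _≡_ (u ∷ w ∷ []) (DiPath.vertices (path x y e))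

-- S is isomorphic to a (not necessarily induced) subdigraph of D, namely to
-- its image under the embedding.
_IsSubdigraphOf_ : Digraph → Digraph → Set
S IsSubdigraphOf D = Σ (Digraph.V S → Digraph.V D) λ f →
  Injective _≡_ _≡_ f ×
  (∀ x y → Digraph._⟶_ S x y → Digraph._⟶_ D (f x) (f y))

ContainsSubdivision : Digraph → Digraph → Set
ContainsSubdivision D F = ∃[ S ] IsSubdivision S F × S IsSubdigraphOf D

ForcesSubdivision : Digraph → ℕ → Set
ForcesSubdivision F k =
  ∀ D m → IsDichromaticNumber D m → m ≥ k → ContainsSubdivision D F

IsMaderNumber : Digraph → ℕ → Set
IsMaderNumber F = IsLeast (λ k → k ≥ 1 × ForcesSubdivision F k)

-- Upper bound: a maximal acyclic set X of a vertex set P can serve as one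
-- colour class, and by maximality every vertex of P outside X lies on a
-- directed cycle whose other vertices are all in X.  Such a cycle is exactly a
-- subdivided digon, so it hangs a new leaf on a subdivision found in P ∖ X.
-- A forest on n vertices arises from a single vertex by hanging n ∸ 1 leaves
-- (isolated vertices may be hung anywhere), which costs n ∸ 1 colours.
-- Lower bound: complete digraphs on fewer than n vertices.

module Submission where

open import Defs

open import Data.Bool.Properties using (T?)
open import Data.Empty using (⊥)
open import Data.Fin.Base using (Fin; zero; toℕ; fromℕ<)
open import Data.Fin.Properties
  using (_≟_; any?; injective⇒≤; pigeonhole; toℕ-fromℕ<) renaming (<⇒≢ to F<⇒≢)
open import Data.List.Base
  using (List; []; _∷_; [_]; _++_; length; map; lookup; filter; allFin)
open import Data.List.Membership.Propositional using (_∈_; _∉_)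
open import Data.List.Membership.Propositional.Properties
  using (∈-∃++; ∈-++⁺ʳ; ∈-filter⁺; ∈-filter⁻; ∈-lookup; ∈-allFin; ∈-length; ∈-map⁺; ∈-map⁻)
import Data.List.Membership.DecPropositional as DecMembership
open import Data.List.Properties using (filter-notAll; map-++; ++-assoc)
open import Data.List.Relation.Binary.Disjoint.Propositional using (Disjoint)
open import Data.List.Relation.Binary.Infix.Heterogeneous as Infix using (Infix; here; there)
open import Data.List.Relation.Binary.Infix.Heterogeneous.Properties as Infix using (infix?)
open import Data.List.Relation.Binary.Permutation.Propositional using (_↭_; ↭⇒↭ₛ)
open import Data.List.Relation.Binary.Permutation.Propositional.Properties using (++-comm)
import Data.List.Relation.Binary.Permutation.Setoid.Properties as Permutation
open import Data.List.Relation.Binary.Prefix.Heterogeneous using ([]; _∷_)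
open import Data.List.Relation.Unary.All as All using (All; []; _∷_)
import Data.List.Relation.Unary.All.Properties as All
open import Data.List.Relation.Unary.AllPairs using ([]; _∷_)
open import Data.List.Relation.Unary.Any as Any using (here; there)
import Data.List.Relation.Unary.Any.Properties as Any
open import Data.List.Relation.Unary.Linked as Linked using (Linked; []; [-]; _∷_; linked?)
import Data.List.Relation.Unary.Linked.Properties as Linked
import Data.List.Relation.Unary.Unique.DecPropositional as DecUnique
open import Data.List.Relation.Unary.Unique.Propositional using (Unique)
import Data.List.Relation.Unary.Unique.Propositional.Properties as Unique
open import Data.Nat.Base
  using (ℕ; zero; suc; NonZero; _+_; _≤_; _<_; z≤n; s≤s; s≤s⁻¹; >-nonZero; >-nonZero⁻¹)
open import Data.Nat.Properties
  using (≤-refl; ≤-trans; <⇒≱; ≮⇒≥; n≤1+n; +-identityʳ; +-suc; suc-injective)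
open import Data.Product.Base using (Σ; ∃; ∃-syntax; _×_; _,_; proj₁; proj₂)
open import Data.Sum.Base using (_⊎_; inj₁; inj₂)
open import Data.Unit.Base using (⊤; tt)
open import Function.Base using (_∘_; id; case_of_)
open import Function.Definitions using (Injective)
open import Relation.Binary.PropositionalEquality
  using (_≡_; _≢_; refl; sym; trans; cong; cong₂; subst; setoid)
open import Relation.Nullary.Decidable
  using (Dec; yes; no; ⌊_⌋; toWitness; fromWitness; _×-dec_; _⊎-dec_; ¬?; map′; decidable-stable)
open import Relation.Nullary.Negation using (¬_; contradiction)
open import Relation.Unary using (Decidable)

vertex : ∀ {n} → NonZero n → Fin n
vertex {suc _} _ = zero

-- Lists

module _ {A : Set} {R : A → A → Set} where

  linked-++ˡ : ∀ xs {ys} → Linked R (xs ++ ys) → Linked R xs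
  linked-++ˡ []           _       = []
  linked-++ˡ (x ∷ [])     _       = [-]
  linked-++ˡ (x ∷ y ∷ xs) (r ∷ l) = r ∷ linked-++ˡ (y ∷ xs) l

  linked-++ʳ : ∀ xs {ys} → Linked R (xs ++ ys) → Linked R ys
  linked-++ʳ []       l = l
  linked-++ʳ (x ∷ xs) l = linked-++ʳ xs (Linked.tail l)

  linked-glue : ∀ xs {y ys} → Linked R (xs ++ [ y ]) → Linked R (y ∷ ys) →
                Linked R (xs ++ y ∷ ys)
  linked-glue []           _       l = l
  linked-glue (x ∷ [])     (r ∷ _) l = r ∷ l
  linked-glue (x ∷ z ∷ xs) (r ∷ k) l = r ∷ linked-glue (z ∷ xs) k l

  linked-infix : ∀ {x y zs} → Infix _≡_ (x ∷ y ∷ []) zs → Linked R zs → R x y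
  linked-infix (here (refl ∷ refl ∷ _)) (r ∷ _) = r
  linked-infix (there i)                l       = linked-infix i (Linked.tail l)

module _ {A : Set} where

  -- Serves the digraph `H` built further down: its arcs are the consecutive pairs of trails, so
  -- this links every trail in `H`.
  self-linked : ∀ (zs : List A) → Linked (λ x y → Infix _≡_ (x ∷ y ∷ []) zs) zs
  self-linked []           = []
  self-linked (x ∷ [])     = [-]
  self-linked (x ∷ y ∷ zs) =
    here (refl ∷ refl ∷ []) ∷ Linked.map there (self-linked (y ∷ zs))

  unique-++ˡ : ∀ (xs : List A) {ys} → Unique (xs ++ ys) → Unique xs
  unique-++ˡ []       _       = []
  unique-++ˡ (x ∷ xs) (p ∷ u) = All.++⁻ˡ xs p ∷ unique-++ˡ xs u

  unique-resp-↭ : ∀ {xs ys : List A} → xs ↭ ys → Unique xs → Unique ys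
  unique-resp-↭ = Permutation.Unique-resp-↭ (setoid A) ∘ ↭⇒↭ₛ

  lookup-injective : ∀ {xs : List A} → Unique xs → Injective _≡_ _≡_ (lookup xs)
  lookup-injective {x ∷ xs} (p ∷ u) {Fin.zero}  {Fin.zero}  eq = refl
  lookup-injective {x ∷ xs} (p ∷ u) {Fin.zero}  {Fin.suc j} eq =
    contradiction eq (All.lookup p (∈-lookup j))
  lookup-injective {x ∷ xs} (p ∷ u) {Fin.suc i} {Fin.zero}  eq =
    contradiction (sym eq) (All.lookup p (∈-lookup i))
  lookup-injective {x ∷ xs} (p ∷ u) {Fin.suc i} {Fin.suc j} eq =
    cong Fin.suc (lookup-injective u eq)

  ∉⇒All≢ : ∀ {x : A} {xs} → x ∉ xs → All (x ≢_) xs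
  ∉⇒All≢ x∉ = All.¬Any⇒All¬ _ x∉

module _ {n : ℕ} where

  open DecMembership (_≟_ {n}) public using (_∈?_)

  unique-length : {xs : List (Fin n)} → Unique xs → length xs ≤ n
  unique-length u = injective⇒≤ (lookup-injective u)

  -- Makes the search for dicycles decidable: the lists over `Fin n` of bounded length are tried
  -- entry by entry.
  any-list? : ∀ m {Q : List (Fin n) → Set} → Decidable Q →
              Dec (∃[ xs ] length xs ≤ m × Q xs)
  any-list? zero Q? = map′ (λ q → [] , z≤n , q) (λ { ([] , _ , q) → q }) (Q? [])
  any-list? (suc m) {Q} Q? =
    map′ to from (Q? [] ⊎-dec any? (λ x → any-list? m (Q? ∘ (x ∷_))))
    where
    to : Q [] ⊎ (∃[ x ] ∃[ xs ] length xs ≤ m × Q (x ∷ xs)) →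
         ∃[ xs ] length xs ≤ suc m × Q xs
    to (inj₁ q)                = [] , z≤n , q
    to (inj₂ (x , xs , l , q)) = x ∷ xs , s≤s l , q

    from : (∃[ xs ] length xs ≤ suc m × Q xs) →
           Q [] ⊎ (∃[ x ] ∃[ xs ] length xs ≤ m × Q (x ∷ xs))
    from ([]     , _     , q) = inj₁ q
    from (x ∷ xs , s≤s l , q) = inj₂ (x , xs , l , q)

-- Maximal acyclic sets

module _ (D : Digraph) where
  open Digraph D

  private
    dicycle? : ∀ x xs → Dec (IsDicycle D x xs)
    dicycle? x xs = linked? (λ _ _ → T? _) (x ∷ xs ++ [ x ]) ×-dec DecUnique.unique? _≟_ (x ∷ xs)

  -- Cutting the closed walk at `v` leaves a walk from `x` to `v` and one from `v` to `x`; they are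
  -- glued at `x` in the other order.
  rotate : ∀ {x v} as bs → IsDicycle D x (as ++ v ∷ bs) → IsDicycle D v (bs ++ x ∷ as)
  rotate {x} {v} as bs (l , u) =
    subst (λ zs → Linked _⟶_ (v ∷ zs)) (sym (++-assoc bs (x ∷ as) [ v ]))
      (linked-glue (v ∷ bs) (linked-++ʳ (x ∷ as) l′)
        (linked-++ˡ (x ∷ as ++ [ v ])
          (subst (λ zs → Linked _⟶_ (x ∷ zs)) (sym (++-assoc as [ v ] (bs ++ [ x ]))) l′))) ,
    unique-resp-↭ (++-comm (x ∷ as) (v ∷ bs)) u
    where
    l′ : Linked _⟶_ (x ∷ as ++ v ∷ bs ++ [ x ])
    l′ = subst (λ zs → Linked _⟶_ (x ∷ zs)) (++-assoc as (v ∷ bs) [ x ]) l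

  CycleInto : (V → Set) → V → Set
  CycleInto X v = ∃[ xs ] All X xs × IsDicycle D v xs

  cycleInto? : ∀ {X} → Decidable X → Decidable (CycleInto X)
  cycleInto? X? v =
    map′ (λ (xs , _ , q) → xs , q)
         -- A dicycle repeats no vertex, so the bound `order` on the length of `xs` loses none.
         (λ (xs , a , c) → xs , ≤-trans (n≤1+n _) (unique-length (proj₂ c)) , a , c)
         (any-list? order (λ xs → All.all? X? xs ×-dec dicycle? v xs))

  -- A dicycle that avoids `v` lies in `X`. One that meets `v` can be rotated to start there, and
  -- its other vertices then lie in `X`.
  insert-acyclic : ∀ {X v} → ¬ CycleInto X v → InducesAcyclic D X →
                   InducesAcyclic D (λ u → X u ⊎ u ≡ v)
  insert-acyclic {X} {v} ¬into acyclic x xs ps cyc = avoid (v ∈? (x ∷ xs))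
    where
    drop : ∀ {ys} → All (λ u → X u ⊎ u ≡ v) ys → All (v ≢_) ys → All X ys
    drop []            []       = []
    drop (inj₁ p ∷ ps) (_ ∷ ns) = p ∷ drop ps ns
    drop (inj₂ e ∷ ps) (n ∷ ns) = contradiction (sym e) n

    from-v : ∀ {ys} → All (λ u → X u ⊎ u ≡ v) ys → IsDicycle D v ys → CycleInto X v
    from-v ps cyc@(_ , v∉ys ∷ _) = _ , drop ps v∉ys , cyc

    through : ∀ {x xs} → v ∈ x ∷ xs → All (λ u → X u ⊎ u ≡ v) (x ∷ xs) → IsDicycle D x xs →
              CycleInto X v
    through (here refl) (_ ∷ ps) cyc = from-v ps cyc
    through (there v∈xs) (p ∷ ps) cyc with as , bs , refl ← ∈-∃++ v∈xs =
      from-v (All.++⁺ (All.tail (All.++⁻ʳ as ps)) (p ∷ All.++⁻ˡ as ps)) (rotate as bs cyc)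

    avoid : Dec (v ∈ x ∷ xs) → ⊥
    avoid (no v∉)  = acyclic x xs (drop ps (∉⇒All≢ v∉)) cyc
    avoid (yes v∈) = ¬into (through v∈ ps cyc)

  -- The list `vs` holds the vertices already considered. Maximality is claimed for these alone,
  -- which makes the record the invariant of the greedy construction.
  record GreedyAcyclic (P : V → Set) (vs : List V) : Set₁ where
    field
      X       : V → Set
      X?      : Decidable X
      X⊆P     : ∀ {v} → X v → P v
      acyclic : InducesAcyclic D X
      maximal : ∀ {v} → v ∈ vs → P v → ¬ X v → CycleInto X v

  greedy-acyclic : ∀ {P} → Decidable P → ∀ vs → GreedyAcyclic P vs
  greedy-acyclic P? [] = record
    { X = λ _ → ⊥ ; X? = λ _ → no id ; X⊆P = λ () ; acyclic = λ { _ _ (() ∷ _) } ; maximal = λ () }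
  greedy-acyclic P? (w ∷ vs) = case P? w ×-dec ¬? (cycleInto? G.X? w) of λ where
      (yes (Pw , ¬into)) → record
        { X       = λ u → G.X u ⊎ u ≡ w
        ; X?      = λ u → G.X? u ⊎-dec u ≟ w
        ; X⊆P     = λ { (inj₁ p) → G.X⊆P p ; (inj₂ refl) → Pw }
        ; acyclic = insert-acyclic ¬into G.acyclic
        ; maximal = λ where
            (here refl) _ ∉X → contradiction (inj₂ refl) ∉X
            -- A rejected vertex stays rejected, because its dicycle into the smaller set is also
            -- one into the larger set.
            (there v∈) Pv ∉X → let xs , a , c = G.maximal v∈ Pv (∉X ∘ inj₁) in xs , All.map inj₁ a , c
        }
      (no blocked) → record
        { X = G.X ; X? = G.X? ; X⊆P = G.X⊆P ; acyclic = G.acyclic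
        ; maximal = λ where
            (here refl) Pw _ → decidable-stable (cycleInto? G.X? w) (λ ¬into → blocked (Pw , ¬into))
            (there v∈)       → G.maximal v∈
        }
    where module G = GreedyAcyclic (greedy-acyclic P? vs)

  MaximalAcyclic : (V → Set) → Set₁
  MaximalAcyclic P = GreedyAcyclic P (allFin order)

  -- Unlike AcyclicColorable, colours only the vertices in P, and with natural
  -- numbers, so that P may be empty and k zero.
  Colourable : (V → Set) → ℕ → Set
  Colourable P k = Σ (V → ℕ) λ c →
    (∀ {x} → P x → c x < k) × ∀ i → InducesAcyclic D (λ x → P x × c x ≡ i)

  -- Colour 0 goes to the acyclic set of `M`, and the colours of all other vertices move up by one.
  colour-class : ∀ {P k} (M : MaximalAcyclic P) →
                 Colourable (λ x → P x × ¬ GreedyAcyclic.X M x) k → Colourable P (suc k)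
  colour-class {P} {k} M (c , c< , cls) = c′ , c′< , cls′
    where
    open GreedyAcyclic M

    colour : ∀ {x} → Dec (X x) → ℕ
    colour     (yes _) = 0
    colour {x} (no _)  = suc (c x)

    c′ : V → ℕ
    c′ x = colour (X? x)

    c′< : ∀ {x} → P x → c′ x < suc k
    c′< {x} p with X? x
    ... | yes _ = s≤s z≤n
    ... | no ∉X = s≤s (c< (p , ∉X))

    class-zero : ∀ {x} → P x × c′ x ≡ 0 → X x
    class-zero {x} _ with yes ∈X ← X? x = ∈X

    class-suc : ∀ {x i} → P x × c′ x ≡ suc i → (P x × ¬ X x) × c x ≡ i
    class-suc {x} (p , eq) with no ∉X ← X? x = (p , ∉X) , suc-injective eq

    cls′ : ∀ i → InducesAcyclic D (λ x → P x × c′ x ≡ i)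
    cls′ zero    x xs a = acyclic x xs (All.map class-zero a)
    cls′ (suc i) x xs a = cls i x xs (All.map class-suc a)

  colourable⇒acyclicColorable : ∀ {k} → Colourable (λ _ → ⊤) k → AcyclicColorable D k
  colourable⇒acyclicColorable (c , c< , cls) =
    (λ x → fromℕ< (c< {x} tt)) ,
    λ i x xs a → cls (toℕ i) x xs (All.map (λ eq → tt , trans (sym (toℕ-fromℕ< _)) (cong toℕ eq)) a)

-- Pruning a forest

module _ (G : Graph) where
  open Graph G

  -- The vertex `z` has at most one neighbour in `L`, namely `p`, but `z ∼ p` is not demanded: a
  -- vertex without neighbours in `L` may be attached anywhere. The index counts the attachments,
  -- hence the colours to be spent.
  data Pruning : ℕ → List V → Set where
    root   : ∀ z → Pruning 0 [ z ]
    attach : ∀ {k z p L} → z ∉ L → p ∈ L → (∀ {y} → y ∈ L → z ∼ y → y ≡ p) →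
             Pruning k L → Pruning (suc k) (z ∷ L)

  pruning-length : ∀ {k L} → Pruning k L → length L ≡ suc k
  pruning-length (root _)         = refl
  pruning-length (attach _ _ _ p) = cong suc (pruning-length p)

  pruning-unique : ∀ {k L} → Pruning k L → Unique L
  pruning-unique (root _)          = [] ∷ []
  pruning-unique (attach z∉ _ _ p) = ∉⇒All≢ z∉ ∷ pruning-unique p

  -- A vertex with no neighbour in `R` counts as a leaf as well.
  IsLeaf : List V → V → Set
  IsLeaf R z = ∀ {x y} → x ∈ R → y ∈ R → z ∼ x → z ∼ y → x ≡ y

  module _ (forest : IsForest G) (R : List V) where

    -- The edge from `h` to `y` would close the segment `h`, `s`, `as`, `y` of the path into a cycle
    -- on at least three vertices.
    no-chord : ∀ {h s y t} → Linked _∼_ (h ∷ s ∷ t) → Unique (h ∷ s ∷ t) → y ∈ t → ¬ (h ∼ y)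
    no-chord {h} {s} {y} l u y∈t h∼y with as , bs , refl ← ∈-∃++ y∈t =
      forest h (s ∷ as ++ [ y ])
        ( subst (λ zs → Linked _∼_ (h ∷ s ∷ zs)) (sym (++-assoc as [ y ] [ h ]))
            (linked-glue (h ∷ s ∷ as)
              (linked-++ˡ (h ∷ s ∷ as ++ [ y ])
                (subst (λ zs → Linked _∼_ (h ∷ s ∷ zs)) (sym (++-assoc as [ y ] bs)) l))
              (symmetric h y h∼y ∷ [-]))
        , unique-++ˡ (h ∷ s ∷ as ++ [ y ])
            (subst (λ zs → Unique (h ∷ s ∷ zs)) (sym (++-assoc as [ y ] bs)) u)
        , s≤s (∈-length (∈-++⁺ʳ as (here refl))) )

    -- Extends the path, listed from its last vertex backwards, until it is
    -- stuck at a leaf.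
    walk : ∀ fuel {h t} → order < length (h ∷ t) + fuel → Linked _∼_ (h ∷ t) → Unique (h ∷ t) →
           h ∈ R → ∃[ z ] z ∈ R × IsLeaf R z
    -- Path length and remaining fuel together exceed `order`, so an exhausted supply means a path
    -- with more vertices than the graph.
    walk zero    lt l u h∈ =
      contradiction (unique-length u) (<⇒≱ (subst (order <_) (+-identityʳ _) lt))
    walk (suc f) {h} {[]} lt l u h∈ with any? (λ y → y ∈? R ×-dec T? (edge h y))
    ... | no none = h , h∈ , λ x∈ _ h∼x → contradiction (_ , x∈ , h∼x) none
    ... | yes (y , y∈ , h∼y) =
      walk f (subst (order <_) (+-suc _ f) lt) (symmetric h y h∼y ∷ l)
        (((λ { refl → loopless h h∼y }) ∷ []) ∷ u) y∈
    walk (suc f) {h} {s ∷ t} lt l u h∈ with any? (λ y → y ∈? R ×-dec T? (edge h y) ×-dec ¬? (y ≟ s))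
    ... | no none = h , h∈ , λ x∈ y∈ h∼x h∼y → trans (only x∈ h∼x) (sym (only y∈ h∼y))
      where
      only : ∀ {x} → x ∈ R → h ∼ x → x ≡ s
      only x∈ h∼x = decidable-stable (_ ≟ s) (λ x≢s → none (_ , x∈ , h∼x , x≢s))
    -- The vertex `y` is new to the path: it differs from `h` by looplessness, from `s` by choice,
    -- and from the vertices of `t` by `no-chord`.
    ... | yes (y , y∈ , h∼y , y≢s) =
      walk f (subst (order <_) (+-suc _ f) lt) (symmetric h y h∼y ∷ l)
        (((λ { refl → loopless h h∼y }) ∷ y≢s ∷ ∉⇒All≢ (λ y∈t → no-chord l u y∈t h∼y)) ∷ u) y∈

  leaf : IsForest G → ∀ {R x} → x ∈ R → ∃[ z ] z ∈ R × IsLeaf R z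
  leaf forest {R} x∈ = walk forest R order ≤-refl [-] ([] ∷ []) x∈

  -- Induction on a bound `m` for the length: a leaf `z` is filtered out with all its copies, the
  -- rest is pruned, and `z` is attached last. `R` may have repetitions while `L` has none, so only
  -- membership is compared.
  prune : IsForest G → ∀ m R {x} → length R ≤ m → x ∈ R →
          ∃[ k ] ∃[ L ] Pruning k L × (∀ {y} → y ∈ L → y ∈ R) × (∀ {y} → y ∈ R → y ∈ L)
  prune forest zero    []      _   ()
  prune forest zero    (_ ∷ _) ()  _
  prune forest (suc m) R       len x∈ with z , z∈ , lf ← leaf forest x∈ = go (R′ , refl)
    where
    ≢z? : Decidable (_≢ z)
    ≢z? y = ¬? (y ≟ z)

    R′ : List V
    R′ = filter ≢z? R

    len′ : length R′ ≤ m
    len′ = s≤s⁻¹ (≤-trans (filter-notAll ≢z? R (Any.map (λ { refl n → n refl }) z∈)) len)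

    cover : ∀ {y L} → (∀ {w} → w ∈ R′ → w ∈ L) → y ∈ R → y ∈ z ∷ L
    cover {y} sup y∈ with y ≟ z
    ... | yes y≡z = here y≡z
    ... | no  y≢z = there (sup (∈-filter⁺ ≢z? y∈ y≢z))

    neighbour : ∀ {q} → q ∈ R′ → ∃[ p ] p ∈ R′ × (∀ {y} → y ∈ R → z ∼ y → y ≡ p)
    neighbour {q} q∈ with any? (λ y → y ∈? R′ ×-dec T? (edge z y))
    ... | yes (p , p∈ , z∼p) = p , p∈ , λ y∈ z∼y → lf y∈ (proj₁ (∈-filter⁻ ≢z? p∈)) z∼y z∼p
    -- With no neighbour left, any remaining vertex can act as attachment point; `q` is at hand.
    ... | no none = q , q∈ , λ {y} y∈ z∼y →
      contradiction (y , ∈-filter⁺ ≢z? y∈ (λ { refl → loopless z z∼y }) , z∼y) none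

    go : (∃ λ S → S ≡ R′) →
         ∃[ k ] ∃[ L ] Pruning k L × (∀ {y} → y ∈ L → y ∈ R) × (∀ {y} → y ∈ R → y ∈ L)
    go ([] , eq) = 0 , [ z ] , root z , (λ { (here refl) → z∈ }) ,
      cover (subst (_ ∈_) (sym eq))
    go (q ∷ _ , eq)
      with q∈ ← subst (q ∈_) eq (here refl)
      with p , p∈ , only ← neighbour q∈
         | k , L , pr , sub , sup ← prune forest m R′ len′ q∈ =
      suc k , z ∷ L ,
      attach (λ z∈L → proj₂ (∈-filter⁻ ≢z? {xs = R} (sub z∈L)) refl) (sup p∈)
        (λ y∈L → only (proj₁ (∈-filter⁻ ≢z? (sub y∈L)))) pr ,
      (λ { (here refl) → z∈ ; (there y∈) → proj₁ (∈-filter⁻ ≢z? (sub y∈)) }) ,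
      cover sup

-- Subdivisions inside a digraph

module _ (G : Graph) (D : Digraph) where
  private
    module G = Graph G
    module D = Digraph D
  open Graph G using (_∼_)

  -- A subdivision in D[P] of the biorientation of G[L]; branch and inner have
  -- junk values outside L and on non-edges.
  record SubdivisionOn (L : List G.V) (P : D.V → Set) : Set where
    Edge : G.V → G.V → Set
    Edge x y = x ∈ L × y ∈ L × x ∼ y

    field
      branch           : G.V → D.V
      inner            : G.V → G.V → List D.V
      branch-in        : ∀ {x} → x ∈ L → P (branch x)
      inner-in         : ∀ {x y} → Edge x y → All P (inner x y)
      branch-injective : ∀ {x y} → x ∈ L → y ∈ L → branch x ≡ branch y → x ≡ y
      linked           : ∀ {x y} → Edge x y → Linked D._⟶_ (branch x ∷ inner x y ++ [ branch y ])
      inner-unique     : ∀ {x y} → Edge x y → Unique (inner x y)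
      inner-new        : ∀ {x y z} → Edge x y → z ∈ L → branch z ∉ inner x y
      inner-disjoint   : ∀ {x y x′ y′} → Edge x y → Edge x′ y′ → (x , y) ≢ (x′ , y′) →
                         Disjoint (inner x y) (inner x′ y′)

  single-vertex : ∀ z {P w} → P w → SubdivisionOn [ z ] P
  single-vertex z {P} {w} p = record
    { branch           = λ _ → w
    ; inner            = λ _ _ → []
    ; branch-in        = λ _ → p
    ; inner-in         = λ _ → []
    ; branch-injective = λ { (here refl) (here refl) _ → refl }
    ; linked           = λ { (here refl , here refl , e) → contradiction e (G.loopless z) }
    ; inner-unique     = λ _ → []
    ; inner-new        = λ { _ _ () }
    ; inner-disjoint   = λ { _ _ _ (() , _) }
    }

  module _ {L z p} (z∉L : z ∉ L) (p∈L : p ∈ L) (only-p : ∀ {y} → y ∈ L → z ∼ y → y ≡ p)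
           {P : D.V → Set} (M : MaximalAcyclic D P)
           (S : SubdivisionOn L (λ v → P v × ¬ GreedyAcyclic.X M v)) where
    private module S = SubdivisionOn S
    open GreedyAcyclic M

    -- The dicycle branch p → w → … → branch p supplies the new branch vertex w,
    -- the path from branch p to w (a single arc), and the path back, with inner vertices ws.
    hang : ∀ {w ws} → All X (w ∷ ws) → IsDicycle D (S.branch p) (w ∷ ws) → SubdivisionOn (z ∷ L) P
    hang {w} {ws} (Xw ∷ Xws) (bp→w ∷ back , _ ∷ w∉ws ∷ uws) = record
      { branch           = branch′
      ; inner            = inner′
      ; branch-in        = λ x∈ → branch-in (view-branch x∈)
      ; inner-in         = λ e → inner-in (view-inner e)
      ; branch-injective = λ x∈ y∈ → branch-injective (view-branch x∈) (view-branch y∈)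
      ; linked           = λ e@(x∈ , y∈ , _) → linked (view-inner e) (view-branch x∈) (view-branch y∈)
      ; inner-unique     = λ e → unique (view-inner e)
      ; inner-new        = λ e z∈ → new (view-inner e) (view-branch z∈)
      ; inner-disjoint   = λ e e′ → disjoint (view-inner e) (view-inner e′)
      }
      where
      branch′ : G.V → D.V
      branch′ x with x ≟ z
      ... | yes _ = w
      ... | no  _ = S.branch x

      inner′ : G.V → G.V → List D.V
      inner′ x y with x ≟ z | y ≟ z
      ... | yes _ | _     = ws
      ... | no  _ | yes _ = []
      ... | no  _ | no  _ = S.inner x y

      -- `Branch` and `Inner` are views of `branch′` and `inner′`: the fields are proved by cases on
      -- them, without repeating the tests `x ≟ z`.
      data Branch (x : G.V) (v : D.V) : Set where
        fresh : x ≡ z → v ≡ w → Branch x v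
        old   : x ∈ L → v ≡ S.branch x → Branch x v

      data Inner (x y : G.V) (vs : List D.V) : Set where
        from-z : x ≡ z → y ≡ p → vs ≡ ws → Inner x y vs
        to-z   : x ≡ p → y ≡ z → vs ≡ [] → Inner x y vs
        old    : S.Edge x y → vs ≡ S.inner x y → Inner x y vs

      tail∈ : ∀ {x} → x ∈ z ∷ L → x ≢ z → x ∈ L
      tail∈ (here x≡z) x≢z = contradiction x≡z x≢z
      tail∈ (there x∈) _   = x∈

      view-branch : ∀ {x} → x ∈ z ∷ L → Branch x (branch′ x)
      view-branch {x} x∈ with x ≟ z
      ... | yes x≡z = fresh x≡z refl
      ... | no  x≢z = old (tail∈ x∈ x≢z) refl

      -- There is no loop at `z`, and by `only-p` and symmetry an edge between `z` and `L` has its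
      -- other end at `p`.
      view-inner : ∀ {x y} → x ∈ z ∷ L × y ∈ z ∷ L × x ∼ y → Inner x y (inner′ x y)
      view-inner {x} {y} (x∈ , y∈ , x∼y) with x ≟ z | y ≟ z
      ... | yes refl | yes refl = contradiction x∼y (G.loopless x)
      ... | yes refl | no y≢z   = from-z refl (only-p (tail∈ y∈ y≢z) x∼y) refl
      ... | no x≢z   | yes refl = to-z (only-p (tail∈ x∈ x≢z) (G.symmetric x y x∼y)) refl refl
      ... | no x≢z   | no y≢z   = old (tail∈ x∈ x≢z , tail∈ y∈ y≢z , x∼y) refl

      -- The old subdivision lives outside `X`, whereas `w` and `ws` lie inside. This separates old
      -- branch vertices from new material; the same contrast separates the inner vertices.
      old≢X : ∀ {x v} → x ∈ L → X v → S.branch x ≢ v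
      old≢X x∈ Xv refl = proj₂ (S.branch-in x∈) Xv

      branch-in : ∀ {x v} → Branch x v → P v
      branch-in (fresh _ refl) = X⊆P Xw
      branch-in (old x∈ refl)  = proj₁ (S.branch-in x∈)

      inner-in : ∀ {x y vs} → Inner x y vs → All P vs
      inner-in (from-z _ _ refl) = All.map X⊆P Xws
      inner-in (to-z _ _ refl)   = []
      inner-in (old e refl)      = All.map proj₁ (S.inner-in e)

      branch-injective : ∀ {x y u v} → Branch x u → Branch y v → u ≡ v → x ≡ y
      branch-injective (fresh refl _)    (fresh refl _)    _  = refl
      branch-injective (fresh _ refl)    (old y∈ refl)     eq = contradiction (sym eq) (old≢X y∈ Xw)
      branch-injective (old x∈ refl)     (fresh _ refl)    eq = contradiction eq (old≢X x∈ Xw)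
      branch-injective (old x∈ refl)     (old y∈ refl)     eq = S.branch-injective x∈ y∈ eq

      branch-z : ∀ {v} → Branch z v → v ≡ w
      branch-z (fresh _ v≡w) = v≡w
      branch-z (old z∈ _)    = contradiction z∈ z∉L

      branch-old : ∀ {x v} → x ∈ L → Branch x v → v ≡ S.branch x
      branch-old x∈ (fresh refl _) = contradiction x∈ z∉L
      branch-old x∈ (old _ eq)     = eq

      linked : ∀ {x y u v vs} → Inner x y vs → Branch x u → Branch y v →
               Linked D._⟶_ (u ∷ vs ++ [ v ])
      linked (from-z refl refl refl) bx by
        with refl ← branch-z bx | refl ← branch-old p∈L by = back
      linked (to-z refl refl refl) bx by
        with refl ← branch-old p∈L bx | refl ← branch-z by = bp→w ∷ [-]
      linked (old e@(x∈ , y∈ , _) refl) bx by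
        with refl ← branch-old x∈ bx | refl ← branch-old y∈ by = S.linked e

      unique : ∀ {x y vs} → Inner x y vs → Unique vs
      unique (from-z _ _ refl) = uws
      unique (to-z _ _ refl)   = []
      unique (old e refl)      = S.inner-unique e

      new : ∀ {x y t v vs} → Inner x y vs → Branch t v → v ∉ vs
      new (from-z _ _ refl) (fresh _ refl) w∈  = All.lookup w∉ws w∈ refl
      new (from-z _ _ refl) (old t∈ refl)  t∈ws = old≢X t∈ (All.lookup Xws t∈ws) refl
      new (to-z _ _ refl)   _              ()
      new (old e refl)      (fresh _ refl) w∈  = proj₂ (All.lookup (S.inner-in e) w∈) Xw
      new (old e refl)      (old t∈ refl)  t∈S = S.inner-new e t∈ t∈S

      disjoint : ∀ {x y x′ y′ vs vs′} → Inner x y vs → Inner x′ y′ vs′ → (x , y) ≢ (x′ , y′) →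
                 Disjoint vs vs′
      -- Both paths belong to the arc from `z` to `p`, so the two pairs coincide.
      disjoint (from-z refl refl _) (from-z refl refl _) ne _           = ne refl
      disjoint (to-z _ _ refl)      _                    _  (() , _)
      disjoint _                    (to-z _ _ refl)      _  (_ , ())
      disjoint (from-z _ _ refl)    (old e refl)         _  (a , b) =
        proj₂ (All.lookup (S.inner-in e) b) (All.lookup Xws a)
      disjoint (old e refl)         (from-z _ _ refl)    _  (a , b) =
        proj₂ (All.lookup (S.inner-in e) a) (All.lookup Xws b)
      disjoint (old e refl)         (old e′ refl)        ne = S.inner-disjoint e e′ ne

    hang-leaf : SubdivisionOn (z ∷ L) P
    -- The vertex `S.branch p` lies in `P` but not in `X`, so maximality provides a dicycle through
    -- it with all other vertices in `X`.
    hang-leaf with Pb , ∉X ← S.branch-in p∈L with maximal (∈-allFin _) Pb ∉X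
    -- A dicycle on one vertex would be a loop.
    ... | []     , _ , (e ∷ _ , _) = contradiction e (D.loopless _)
    ... | _ ∷ _  , a , c           = hang a c

  -- Induction on the pruning, applied to `P` without a maximal acyclic set: a subdivision found
  -- there gets its new leaf through that set, and a colouring found there gets that set as one more
  -- class.
  subdivision-or-colouring : ∀ {k L} → Pruning G k L → ∀ {P} → Decidable P →
                             SubdivisionOn L P ⊎ Colourable D P k
  subdivision-or-colouring (root z) P? with any? P?
  ... | yes (_ , p) = inj₁ (single-vertex z p)
  -- Here `P` is empty, so no colours are needed and the constant 0 is a dummy value.
  ... | no  none    = inj₂ ((λ _ → 0) , (λ p → contradiction (_ , p) none) ,
                            λ { _ x _ ((p , _) ∷ _) → contradiction (x , p) none })
  subdivision-or-colouring (attach z∉ p∈ only pr) P?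
    with M ← greedy-acyclic D P? (allFin (Digraph.order D))
    with subdivision-or-colouring pr (λ v → P? v ×-dec ¬? (GreedyAcyclic.X? M v))
  ... | inj₁ S = inj₁ (hang-leaf z∉ p∈ only M S)
  ... | inj₂ c = inj₂ (colour-class D M c)

-- Realising a subdivision as a digraph of its own

module _ {G : Graph} {D : Digraph} {L : List (Graph.V G)} {P : Digraph.V D → Set}
         (S : SubdivisionOn G D L P) (all∈ : ∀ x → x ∈ L) where
  private
    module G = Graph G
    module D = Digraph D
    module S = SubdivisionOn S
  open Graph G using (_∼_)

  private
    edge : ∀ {x y} → x ∼ y → S.Edge x y
    edge {x} {y} e = all∈ x , all∈ y , e

    trail : G.V → G.V → List D.V
    trail x y = S.branch x ∷ S.inner x y ++ [ S.branch y ]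

    -- Other arcs of `D` between used vertices must be left out, since `arc-covered` admits only
    -- arcs on subdivision paths.
    Arc : D.V → D.V → Set
    Arc u w = ∃[ x ] ∃[ y ] Σ (x ∼ y) λ _ → Infix _≡_ (u ∷ w ∷ []) (trail x y)

    arc? : ∀ u w → Dec (Arc u w)
    arc? u w = any? λ x → any? λ y → T? (G.edge x y) ×-dec infix? _≟_ (u ∷ w ∷ []) (trail x y)

    Arc⇒⟶ : ∀ {u w} → Arc u w → u D.⟶ w
    Arc⇒⟶ (x , y , e , i) = linked-infix i (S.linked (edge e))

    Used : D.V → Set
    Used u = (∃[ x ] u ≡ S.branch x) ⊎ (∃[ x ] ∃[ y ] Σ (x ∼ y) λ _ → u ∈ S.inner x y)

    used? : Decidable Used
    used? u = any? (λ x → u ≟ S.branch x) ⊎-dec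
              any? (λ x → any? λ y → T? (G.edge x y) ×-dec u ∈? S.inner x y)

    -- A repetition-free list, so that its positions can be the vertices of `H` and `lookup` is an
    -- injective embedding into `D`.
    vertices : List D.V
    vertices = filter used? (allFin D.order)

    place : ∀ {u} → Used u → Fin (length vertices)
    place used = Any.index (∈-filter⁺ used? (∈-allFin _) used)

    embed : Fin (length vertices) → D.V
    embed = lookup vertices

    embed-place : ∀ {u} (used : Used u) → embed (place used) ≡ u
    embed-place used = sym (Any.lookup-index (∈-filter⁺ used? (∈-allFin _) used))

    embed-injective : Injective _≡_ _≡_ embed
    embed-injective = lookup-injective (Unique.filter⁺ used? (Unique.allFin⁺ D.order))

    embed-used : ∀ i → Used (embed i)
    embed-used i = proj₂ (∈-filter⁻ used? {xs = allFin D.order} (∈-lookup i))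

    pull : ∀ {us} → All Used us → List (Fin (length vertices))
    pull []       = []
    pull (u ∷ us) = place u ∷ pull us

    map-pull : ∀ {us} (used : All Used us) → map embed (pull used) ≡ us
    map-pull []       = refl
    map-pull (u ∷ us) = cong₂ _∷_ (embed-place u) (map-pull us)

    branch : G.V → Fin (length vertices)
    branch x = place (inj₁ (x , refl))

    embed-branch : ∀ x → embed (branch x) ≡ S.branch x
    embed-branch x = embed-place (inj₁ (x , refl))

    inner-used : ∀ {x y} → x ∼ y → All Used (S.inner x y)
    inner-used e = All.tabulate (λ u∈ → inj₂ (_ , _ , e , u∈))

    inner : ∀ {x y} → x ∼ y → List (Fin (length vertices))
    inner e = pull (inner-used e)

    map-inner : ∀ {x y} (e : x ∼ y) → map embed (inner e) ≡ S.inner x y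
    map-inner e = map-pull (inner-used e)

    embed-inner : ∀ {x y i} (e : x ∼ y) → i ∈ inner e → embed i ∈ S.inner x y
    embed-inner e i∈ = subst (_ ∈_) (map-inner e) (∈-map⁺ embed i∈)

    map-trail : ∀ {x y} (e : x ∼ y) →
                map embed (branch x ∷ inner e ++ [ branch y ]) ≡ trail x y
    map-trail {x} {y} e = cong₂ _∷_ (embed-branch x)
      (trans (map-++ embed (inner e) [ branch y ])
        (cong₂ _++_ (map-inner e) (cong [_] (embed-branch y))))

    infix-embed⁻ : ∀ {i j ks} → Infix _≡_ (embed i ∷ embed j ∷ []) (map embed ks) →
                   Infix _≡_ (i ∷ j ∷ []) ks
    infix-embed⁻ = Infix.map embed-injective ∘ Infix.map⁻ embed embed

    -- Branch vertices are never inner, and the two ends differ because an edge of `G` is no loop.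
    trail-unique : ∀ {x y} → x ∼ y → Unique (trail x y)
    trail-unique {x} {y} e =
      All.++⁺ (∉⇒All≢ (S.inner-new (edge e) (all∈ x))) (bx≢by ∷ []) ∷
      Unique.++⁺ (S.inner-unique (edge e)) ([] ∷ [])
        (λ { (u∈ , here refl) → S.inner-new (edge e) (all∈ y) u∈ })
      where
      bx≢by : S.branch x ≢ S.branch y
      bx≢by eq with refl ← S.branch-injective (all∈ x) (all∈ y) eq = G.loopless x e

    H : Digraph
    H = record
      { order    = length vertices
      ; nonempty = Fin-nonZero (branch (vertex G.nonempty))
      ; arc      = λ i j → ⌊ arc? (embed i) (embed j) ⌋
      ; loopless = λ i a → D.loopless (embed i) (Arc⇒⟶ (toWitness a))
      }
      where
      Fin-nonZero : ∀ {n} → Fin n → NonZero n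
      Fin-nonZero {suc _} _ = _

    path : ∀ x y → x ∼ y → DiPath H (branch x) (branch y)
    path x y e = record
      { inner  = inner e
      -- Each consecutive pair of the trail witnesses an arc of `H`; the links are transported back
      -- along `embed`.
      ; linked = Linked.map (λ i → fromWitness (x , y , e , i))
          (Linked.map⁻ (subst (λ us → Linked (λ u w → Infix _≡_ (u ∷ w ∷ []) (trail x y)) us)
            (sym (map-trail e)) (self-linked (trail x y))))
      ; unique = Unique.map⁻ (subst Unique (sym (map-trail e)) (trail-unique e))
      }

    isSubdivision : IsSubdivision H (biorientation G)
    isSubdivision = record
      { branch           = branch
      ; branch-injective = λ {x} {y} eq → S.branch-injective (all∈ x) (all∈ y)
          (trans (sym (embed-branch x)) (trans (cong embed eq) (embed-branch y)))
      ; path             = path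
      ; inner-new        = λ x y e z z∈ → S.inner-new (edge e) (all∈ z)
          (subst (_∈ S.inner x y) (embed-branch z) (embed-inner e z∈))
      ; inner-disjoint   = λ x y e x′ y′ e′ ne (a , b) → S.inner-disjoint (edge e) (edge e′) ne
          (embed-inner e a , embed-inner e′ b)
      ; vertex-covered   = λ u → covered u (embed-used u)
      ; arc-covered      = λ u w a → let x , y , e , i = toWitness {a? = arc? (embed u) (embed w)} a in
          x , y , e , infix-embed⁻ (subst (Infix _≡_ _) (sym (map-trail e)) i)
      }
      where
      covered : ∀ u → Used (embed u) →
                (∃[ x ] u ≡ branch x) ⊎ (∃[ x ] ∃[ y ] Σ (x ∼ y) λ e → u ∈ inner e)
      covered u (inj₁ (x , eq)) = inj₁ (x , embed-injective (trans eq (sym (embed-branch x))))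
      covered u (inj₂ (x , y , e , u∈))
        with j , j∈ , eq ← ∈-map⁻ embed (subst (embed u ∈_) (sym (map-inner e)) u∈)
        with refl ← embed-injective eq = inj₂ (x , y , e , j∈)

  containsSubdivision : ContainsSubdivision D (biorientation G)
  containsSubdivision =
    H , isSubdivision , embed , embed-injective , λ i j a → Arc⇒⟶ (toWitness a)

-- Complete digraphs

complete : ∀ n → NonZero n → Digraph
complete n nz = record
  { order    = n
  ; nonempty = nz
  ; arc      = λ x y → ⌊ ¬? (x ≟ y) ⌋
  ; loopless = λ x x⟶x → toWitness x⟶x refl
  }

-- Two vertices of equal colour form a monochromatic digon, so by the pigeonhole principle fewer
-- than `n` colours fail, while singleton classes are acyclic.
complete-dichromatic : ∀ n (nz : NonZero n) → IsDichromaticNumber (complete n nz) n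
complete-dichromatic n nz = (id , acyclic) , λ j (c , cls) → ≮⇒≥ λ j<n →
  let x , y , x<y , cx≡cy = pigeonhole j<n c
      x≢y = F<⇒≢ x<y
  in cls (c x) x [ y ] (refl ∷ sym cx≡cy ∷ [])
       ( fromWitness x≢y ∷ fromWitness (x≢y ∘ sym) ∷ [-]
       , (x≢y ∷ []) ∷ [] ∷ [])
  where
  acyclic : ∀ i → InducesAcyclic (complete n nz) (_≡ i)
  acyclic i x []       _                (x⟶x ∷ _ , _)    = toWitness x⟶x refl
  acyclic i x (y ∷ ys) (x≡i ∷ y≡i ∷ _) (_ , (x≢y ∷ _) ∷ _) = x≢y (trans x≡i (sym y≡i))

-- Counting the branch vertices is enough.
containsSubdivision⇒order≤ : ∀ {D F} → ContainsSubdivision D F → v F ≤ v D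
containsSubdivision⇒order≤ (H , sub , f , f-injective , _) =
  injective⇒≤ {f = f ∘ IsSubdivision.branch sub}
    (IsSubdivision.branch-injective sub ∘ f-injective)

-- The Mader number of a bioriented forest

forest-forces : (G : Graph) → IsForest G → ForcesSubdivision (biorientation G) (Graph.order G)
forest-forces G forest D m (_ , least) m≥n
  with x ← vertex (Graph.nonempty G)
  with k , L , pr , _ , all∈ ← prune G forest _ (allFin (Graph.order G)) ≤-refl (∈-allFin x)
  with subdivision-or-colouring G D pr {λ _ → ⊤} (λ _ → yes tt)
... | inj₁ S = containsSubdivision S (λ y → all∈ (∈-allFin y))
-- The list `L` has `suc k` distinct entries, so `k` is less than the order of `G` and hence less
-- than `m`, against the minimality of `m`.
... | inj₂ c = contradiction (least k (colourable⇒acyclicColorable D c))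
  (<⇒≱ (≤-trans (subst (_≤ Graph.order G) (pruning-length G pr) (unique-length (pruning-unique G pr))) m≥n))

corollary9 : (T : Graph) → IsForest T →
    IsMaderNumber (biorientation T) (v (biorientation T))
corollary9 T forest = (>-nonZero⁻¹ _ {{Graph.nonempty T}} , forest-forces T forest) , λ j (j≥1 , forces) →
  -- The complete digraph on `j` vertices has dichromatic number `j`, so it must contain a
  -- subdivision, which takes at least as many vertices as the forest has.
  let K = complete j (>-nonZero j≥1)
  in containsSubdivision⇒order≤ {K} {biorientation T}
       (forces K j (complete-dichromatic j (>-nonZero j≥1)) ≤-refl)
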